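{- Let $\delta \geq 4$ be an integer. There exist infinitely many Kirkman triple systems with chromatic number $\delta$.
   Context: A Kirkman triple system KTS$(n)$ is a Steiner triple system on $n$ points (every pair in exactly one triple) together with a partition of its triples into parallel classes (partitions of the point set). A $\delta$-colouring maps points to $\delta$ colours with no monochromatic triple; the chromatic number is the least such $\delta$. -}

module Defs where

open import Data.Nat using (ℕ; _<_; _≥_)
open import Data.Fin using (Fin)
open import Data.Sum using (_⊎_)
open import Data.Product using (_×_; _,_; Σ; ∃)
open import Data.List using (List; concat)
open import Data.List.Relation.Unary.All using (All)
open import Data.List.Relation.Unary.Any using (Any)
open import Relation.Binary.PropositionalEquality using (_≡_; _≢_)
open import Relation.Nullary using (¬_)

Triple : ℕ → Set
Triple n = Fin n × Fin n × Fin n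

_∈ᵗ_ : ∀ {n} → Fin n → Triple n → Set
x ∈ᵗ (a , b , c) = (x ≡ a) ⊎ ((x ≡ b) ⊎ (x ≡ c))

ProperTriple : ∀ {n} → Triple n → Set
ProperTriple (a , b , c) = (a ≢ b) × (a ≢ c) × (b ≢ c)

open import Data.List.Membership.Propositional using (_∈_)
open import Data.List.Relation.Unary.Any using (index)

ExactlyOne : ∀ {A : Set} → (A → Set) → List A → Set
ExactlyOne P xs = Any P xs × (∀ (p q : Any P xs) → index p ≡ index q)

-- A Steiner triple system on Fin n with the given list of blocks
-- (blocks are listed with multiplicity; "exactly one" forbids repeats
-- of a block containing a pair).
IsSTS : (n : ℕ) → List (Triple n) → Set
IsSTS n blocks =
  All ProperTriple blocks ×
  (∀ (x y : Fin n) → x ≢ y → ExactlyOne (λ t → (x ∈ᵗ t) × (y ∈ᵗ t)) blocks)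

IsParallelClass : (n : ℕ) → List (Triple n) → Set
IsParallelClass n cls = ∀ (x : Fin n) → ExactlyOne (x ∈ᵗ_) cls

record KTS (n : ℕ) : Set where
  field
    classes  : List (List (Triple n))
    isSTS    : IsSTS n (concat classes)
    parallel : All (IsParallelClass n) classes

IsColouring : ∀ {n} → (δ : ℕ) → List (Triple n) → (Fin n → Fin δ) → Set
IsColouring δ blocks f =
  All (λ { (a , b , c) → ¬ ((f a ≡ f b) × (f b ≡ f c)) }) blocks

Colourable : ∀ {n} → List (Triple n) → ℕ → Set
Colourable {n} blocks δ = Σ (Fin n → Fin δ) (IsColouring δ blocks)

ChromaticNumber : ∀ {n} → List (Triple n) → ℕ → Set
ChromaticNumber blocks δ =
  Colourable blocks δ × (∀ k → k < δ → ¬ Colourable blocks k)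

KTSChromatic : ∀ {n} → KTS n → ℕ → Set
KTSChromatic K δ = ChromaticNumber (concat (KTS.classes K)) δ

{-# OPTIONS --safe #-}
module Submission where

-- Tripling a Kirkman triple system on A: on A × Fin 3 put the vertical blocks {x} × Fin 3, and over each
-- block of A a transversal design given by a Latin square of order 3. Each parallel class of A yields
-- three, whatever squares are chosen.
--
-- With the squares i + j + k = 0, iterated tripling multiplies by AG(M,3). Colour focusing shows that
-- large powers are not (δ-1)-colourable: if the same colouring of A appears on two levels u, u′, then
-- the pairs focused at z in level u give pairs (x , u), (y , u′) focused at z in the level collinear
-- with u, u′, and z itself contributes a new one.
--
-- Given a system that is not (δ-1)-colourable, choose δ colours on its points such that already the
-- non-monochromatic blocks are not (δ-1)-colourable. Triple once more, colouring (x , i) by rotating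
-- the colour of x by i steps. Over a non-monochromatic block there is a square that contains (0,0,0)
-- and has no monochromatic triple, because a rotation of δ ≥ 4 colours has no cycle of length ≤ 3; over
-- a monochromatic block i + j + k = 1 will do. Level 0 then prevents a (δ-1)-colouring.

open import Defs
open import Data.Nat using (ℕ; zero; suc; _+_; _*_; _^_; _≤_; _<_; _≥_; z≤n; s≤s; >-nonZero)
open import Data.Product using (Σ; ∃; ∃₂; ∃!; _×_; _,_; proj₁; proj₂; uncurry; swap; -,_)
open import Data.Empty using (⊥)
open import Data.Fin using (Fin; zero; suc; fromℕ; inject₁; inject≤; finToFun; funToFin; _≟_)
open import Data.Fin.Patterns using (0F; 1F; 2F)
import Data.Fin.Properties as Fin
open import Data.List using (List; []; _∷_; _++_; map; concat; concatMap; allFin; tabulate)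
open import Data.List.Membership.Propositional using (_∈_)
open import Data.List.Membership.Propositional.Properties using (∈-map⁺; ∈-concatMap⁺)
open import Data.List.Relation.Unary.All as All using (All; []; _∷_)
import Data.List.Relation.Unary.All.Properties as All
open import Data.List.Relation.Unary.Any as Any using (Any; here; there; index)
open import Data.Maybe using (Maybe; just; nothing)
import Data.Nat.Properties as ℕ
open import Data.Product.Function.NonDependent.Propositional using (_×-↔_)
open import Data.Sum using (_⊎_; inj₁; inj₂; [_,_]′)
open import Data.Unit using (⊤; tt)
open import Function using (_∘_; id; _↔_; Inverse)
open import Function.Properties.Inverse using (↔-refl; ↔-sym; ↔-trans)
open import Relation.Binary.Definitions using (DecidableEquality)
open import Relation.Binary.PropositionalEquality
open import Relation.Nullary using (¬_; Dec; yes; no; contradiction)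
open import Relation.Nullary.Decidable using (map′; from-yes; ¬?; _×-dec_; _⊎-dec_; _→-dec_)

-- Unique occurrence in lists, and enumerations without repetition

module _ {A : Set} where

  -- An inductive form of `ExactlyOne`, which passes through `_++_`, `map` and `concatMap` by
  -- structural recursion, with no comparison of indices.
  data One (P : A → Set) : List A → Set where
    here  : ∀ {x xs} → P x → All (¬_ ∘ P) xs → One P (x ∷ xs)
    there : ∀ {x xs} → ¬ P x → One P xs → One P (x ∷ xs)

  one⇒any : ∀ {P xs} → One P xs → Any P xs
  one⇒any (here p _)  = here p
  one⇒any (there _ o) = there (one⇒any o)

  one⇒exactlyOne : ∀ {P xs} → One P xs → ExactlyOne P xs
  one⇒exactlyOne {P} o = one⇒any o , unique o
    where
    unique : ∀ {xs} → One P xs → (p q : Any P xs) → index p ≡ index q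
    unique (here _ _)   (here _)  (here _)  = refl
    unique (here _ ¬ps) (there p) _         = contradiction p (All.All¬⇒¬Any ¬ps)
    unique (here _ ¬ps) _         (there q) = contradiction q (All.All¬⇒¬Any ¬ps)
    unique (there ¬p _) (here p)  _         = contradiction p ¬p
    unique (there ¬p _) _         (here q)  = contradiction q ¬p
    unique (there _ o)  (there p) (there q) = cong suc (unique o p q)

  one-++ˡ : ∀ {P xs ys} → One P xs → All (¬_ ∘ P) ys → One P (xs ++ ys)
  one-++ˡ (here p ¬ps) ¬qs = here p (All.++⁺ ¬ps ¬qs)
  one-++ˡ (there ¬p o) ¬qs = there ¬p (one-++ˡ o ¬qs)

  one-++ʳ : ∀ {P xs ys} → All (¬_ ∘ P) xs → One P ys → One P (xs ++ ys)
  one-++ʳ []         o = o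
  one-++ʳ (¬p ∷ ¬ps) o = there ¬p (one-++ʳ ¬ps o)

module _ {A B : Set} {P : A → Set} {Q : B → Set} where

  one-map : {g : B → A} → (∀ {b} → Q b → P (g b)) → (∀ {b} → P (g b) → Q b) →
            ∀ {bs} → One Q bs → One P (map g bs)
  one-map to from (here q ¬qs) = here (to q) (All.map⁺ (All.map (_∘ from) ¬qs))
  one-map to from (there ¬q o) = there (¬q ∘ from) (one-map to from o)

  one-concatMap : {g : B → List A} → (∀ {b} → Q b → One P (g b)) →
                  (∀ {b} → ¬ Q b → All (¬_ ∘ P) (g b)) →
                  ∀ {bs} → One Q bs → One P (concatMap g bs)
  one-concatMap yes! no! (here q ¬qs) =
    one-++ˡ (yes! q) (All.concat⁺ (All.map⁺ (All.map no! ¬qs)))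
  one-concatMap yes! no! (there ¬q o) = one-++ʳ (no! ¬q) (one-concatMap yes! no! o)

record Enumeration (A : Set) : Set where
  field
    elements : List A
    once     : ∀ x → One (x ≡_) elements

open Enumeration

none-map : {A B : Set} {P : A → Set} {g : B → A} → (∀ b → ¬ P (g b)) →
           ∀ bs → All (¬_ ∘ P) (map g bs)
none-map ¬p bs = All.map⁺ (All.universal ¬p bs)

⊥-enumeration : Enumeration ⊥
⊥-enumeration .elements = []
⊥-enumeration .once ()

Fin-enumeration : ∀ n → Enumeration (Fin n)
Fin-enumeration n .elements = allFin n
Fin-enumeration n .once     = once-tabulate id id
  where
  once-tabulate : ∀ {m n} (f : Fin m → Fin n) → (∀ {i j} → f i ≡ f j → i ≡ j) →
                  ∀ i → One (f i ≡_) (tabulate f)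
  once-tabulate f inj zero    =
    here refl (All.tabulate⁺ λ j eq → contradiction (inj eq) λ ())
  once-tabulate f inj (suc i) =
    there (λ eq → contradiction (inj eq) λ ())
          (once-tabulate (f ∘ suc) (Fin.suc-injective ∘ inj) i)

↔-enumeration : ∀ {A B} → A ↔ B → Enumeration B → Enumeration A
↔-enumeration A↔B e .elements = map (Inverse.from A↔B) (e .elements)
↔-enumeration A↔B e .once x   =
  one-map (λ eq → trans (sym (Inverse.strictlyInverseʳ A↔B x)) (cong (Inverse.from A↔B) eq))
          (λ eq → trans (cong (Inverse.to A↔B) eq) (Inverse.strictlyInverseˡ A↔B _))
          (e .once (Inverse.to A↔B x))

×-enumeration : ∀ {A B} → Enumeration A → Enumeration B → Enumeration (A × B)
×-enumeration d e .elements = concatMap (λ x → map (x ,_) (e .elements)) (d .elements)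
×-enumeration d e .once (x , y) =
  one-concatMap (λ { refl → one-map (cong (x ,_)) (cong proj₂) (e .once y) })
                (λ x≢ → none-map (λ _ → x≢ ∘ cong proj₁) (e .elements))
                (d .once x)

Maybe-enumeration : ∀ {A} → Enumeration A → Enumeration (Maybe A)
Maybe-enumeration e .elements = nothing ∷ map just (e .elements)
Maybe-enumeration e .once nothing  = here refl (none-map (λ _ ()) (e .elements))
Maybe-enumeration e .once (just x) =
  there (λ ()) (one-map (cong just) (λ { refl → refl }) (e .once x))

-- Blocks are injective functions on Fin 3, so that the positions within a block can be computed with.
_∋_ : {A : Set} → (Fin 3 → A) → A → Set
B ∋ x = ∃ λ p → B p ≡ x

-- Points and labels have arbitrary types, so that tripling can use `A × Fin 3` without renumbering.
-- Uniqueness in `pair` concerns labels, which excludes repeated blocks.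
record Kirkman (A : Set) : Set₁ where
  field
    Class    : Set
    Block    : Class → Set
    classes  : Enumeration Class
    blocks   : ∀ r → Enumeration (Block r)
    block    : ∀ r → Block r → Fin 3 → A
    proper   : ∀ r b {p q} → block r b p ≡ block r b q → p ≡ q
    pair     : ∀ {x y} → x ≢ y →
               ∃! _≡_ λ ((r , b) : Σ Class Block) → block r b ∋ x × block r b ∋ y
    parallel : ∀ r x → ∃! _≡_ λ b → block r b ∋ x

Monochromatic : {C : Set} → (Fin 3 → C) → Set
Monochromatic c = ∀ p q → c p ≡ c q

monochromatic? : ∀ {n} (c : Fin 3 → Fin n) → Dec (Monochromatic c)
monochromatic? c = Fin.all? λ p → Fin.all? λ q → c p ≟ c q

monochromatic : {C : Set} {c : Fin 3 → C} → c 0F ≡ c 1F × c 1F ≡ c 2F → Monochromatic c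
monochromatic {c = c} (e , f) p q = trans (to0 p) (sym (to0 q))
  where
  to0 : ∀ p → c p ≡ c 0F
  to0 0F = refl
  to0 1F = sym e
  to0 2F = trans (sym f) (sym e)

Proper : {A C : Set} → Kirkman A → (A → C) → Set
Proper K f = ∀ r b → ¬ Monochromatic (f ∘ Kirkman.block K r b)

-- From Kirkman systems on finite types to `KTS`

module ToKTS {A : Set} {n : ℕ} (A↔n : A ↔ Fin n) (K : Kirkman A) where
  open Kirkman K
  open Inverse A↔n

  triple : (Fin 3 → A) → Triple n
  triple B = to (B 0F) , to (B 1F) , to (B 2F)

  to-≡⇒ : ∀ {x a} → x ≡ to a → a ≡ from x
  to-≡⇒ refl = sym (strictlyInverseʳ _)

  ⇒to-≡ : ∀ {x a} → a ≡ from x → x ≡ to a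
  ⇒to-≡ refl = sym (strictlyInverseˡ _)

  ∈ᵗ⇒∋ : ∀ {x} B → x ∈ᵗ triple B → B ∋ from x
  ∈ᵗ⇒∋ B (inj₁ eq)        = 0F , to-≡⇒ eq
  ∈ᵗ⇒∋ B (inj₂ (inj₁ eq)) = 1F , to-≡⇒ eq
  ∈ᵗ⇒∋ B (inj₂ (inj₂ eq)) = 2F , to-≡⇒ eq

  ∋⇒∈ᵗ : ∀ {x} B → B ∋ from x → x ∈ᵗ triple B
  ∋⇒∈ᵗ B (0F , eq) = inj₁ (⇒to-≡ eq)
  ∋⇒∈ᵗ B (1F , eq) = inj₂ (inj₁ (⇒to-≡ eq))
  ∋⇒∈ᵗ B (2F , eq) = inj₂ (inj₂ (⇒to-≡ eq))

  class : Class → List (Triple n)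
  class r = map (triple ∘ block r) (blocks r .elements)

  classList : List (List (Triple n))
  classList = map class (classes .elements)

  all-blocks : {P : Triple n → Set} → (∀ r b → P (triple (block r b))) → All P (concat classList)
  all-blocks p = All.concat⁺ (All.map⁺ (All.universal
    (λ r → All.map⁺ (All.universal (p r) (blocks r .elements))) (classes .elements)))

  ∈-blocks : ∀ r b → triple (block r b) ∈ concat classList
  ∈-blocks r b = ∈-concatMap⁺ class
    (Any.map (λ { refl → ∈-map⁺ _ (one⇒any (blocks r .once b)) }) (one⇒any (classes .once r)))

  properTriple : ∀ r b → ProperTriple (triple (block r b))
  properTriple r b = distinct 0F 1F (λ ()) , distinct 0F 2F (λ ()) , distinct 1F 2F (λ ())
    where
    distinct : ∀ p q → p ≢ q → to (block r b p) ≢ to (block r b q)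
    distinct p q p≢q eq = p≢q (proper r b (trans (to-≡⇒ (sym eq)) (strictlyInverseʳ _)))

  kts : KTS n
  kts .KTS.classes = classList
  kts .KTS.isSTS = all-blocks properTriple , λ x y x≢y →
    let (r₀ , b₀) , (x∈ , y∈) , unique =
          pair (λ eq → x≢y (trans (sym (strictlyInverseˡ x)) (trans (cong to eq) (strictlyInverseˡ y))))
        unique′ : ∀ {r b} → x ∈ᵗ triple (block r b) × y ∈ᵗ triple (block r b) →
                  (r₀ , b₀) ≡ (r , b)
        unique′ {r} {b} = λ (x∈ , y∈) → unique (∈ᵗ⇒∋ (block r b) x∈ , ∈ᵗ⇒∋ (block r b) y∈)
    in one⇒exactlyOne (one-concatMap
         (λ { refl → one-map (λ { refl → ∋⇒∈ᵗ _ x∈ , ∋⇒∈ᵗ _ y∈ })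
                             (λ xy∈ → second-≡ (unique′ xy∈)) (blocks r₀ .once b₀) })
         (λ r₀≢r → none-map (λ b xy∈ → r₀≢r (cong proj₁ (unique′ xy∈))) _)
         (classes .once r₀))
    where
    second-≡ : ∀ {r} {b b′ : Block r} → (r , b) ≡ (r , b′) → b ≡ b′
    second-≡ refl = refl
  kts .KTS.parallel = All.map⁺ (All.universal (λ r x →
    let b₀ , x∈ , unique = parallel r (from x)
    in one⇒exactlyOne (one-map (λ { refl → ∋⇒∈ᵗ _ x∈ }) (λ x∈′ → unique (∈ᵗ⇒∋ _ x∈′))
                               (blocks r .once b₀))) (classes .elements))

  isColouring⇒proper : ∀ {k} {f : Fin n → Fin k} →
                       IsColouring k (concat classList) f → Proper K (f ∘ to)
  isColouring⇒proper col r b mono = All.lookup col (∈-blocks r b) (mono 0F 1F , mono 1F 2F)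

  proper⇒isColouring : ∀ {k} {f : A → Fin k} → Proper K f →
                       IsColouring k (concat classList) (f ∘ from)
  proper⇒isColouring {f = f} prop = all-blocks λ r b (e , e′) → prop r b (monochromatic
    (trans (back _) (trans e (sym (back _))) , trans (back _) (trans e′ (sym (back _)))))
    where
    back : ∀ a → f a ≡ f (from (to a))
    back a = cong f (sym (strictlyInverseʳ a))

-- Arithmetic modulo 3

suc₃ : Fin 3 → Fin 3
suc₃ 0F = 1F
suc₃ 1F = 2F
suc₃ 2F = 0F

infixl 6 _⊕_
_⊕_ : Fin 3 → Fin 3 → Fin 3
0F ⊕ j = j
1F ⊕ j = suc₃ j
2F ⊕ j = suc₃ (suc₃ j)

infixl 7 _⊗_
_⊗_ : Fin 3 → Fin 3 → Fin 3
0F ⊗ j = 0F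
1F ⊗ j = j
2F ⊗ j = j ⊕ j

-- The point collinear with i and j in AG(1,3); third i i = i.
third : Fin 3 → Fin 3 → Fin 3
third i j = 2F ⊗ (i ⊕ j)

-- Latin squares of order 3

Square : Set
Square = Fin 3 → Fin 3 → Fin 3 → Fin 3

-- cell s t is a triple of a transversal design on 3 × Fin 3 (the cells of a Latin square with their
-- entries); the first argument s indexes the parallel classes of the design.
record IsLatin (cell : Square) : Set where
  constructor isLatin
  field
    meet     : ∀ p q i j → p ≢ q → ∃₂ λ s t → cell s t p ≡ i × cell s t q ≡ j
    determined : ∀ p q s t s′ t′ → p ≢ q →
                 cell s t p ≡ cell s′ t′ p → cell s t q ≡ cell s′ t′ q → s ≡ s′ × t ≡ t′
    resolve  : ∀ p s i → ∃ λ t → cell s t p ≡ i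
    resolved : ∀ p s t t′ → cell s t p ≡ cell s t′ p → t ≡ t′

isLatin? : ∀ cell → Dec (IsLatin cell)
isLatin? cell = map′ (λ (a , b , c , d) → isLatin a b c d)
  (λ (isLatin a b c d) → a , b , c , d)
  ((Fin.all? λ p → Fin.all? λ q → Fin.all? λ i → Fin.all? λ j → ¬? (p ≟ q) →-dec
     Fin.any? λ s → Fin.any? λ t → (cell s t p ≟ i) ×-dec (cell s t q ≟ j))
  ×-dec (Fin.all? λ p → Fin.all? λ q → Fin.all? λ s → Fin.all? λ t → Fin.all? λ s′ → Fin.all? λ t′ →
     ¬? (p ≟ q) →-dec (cell s t p ≟ cell s′ t′ p) →-dec (cell s t q ≟ cell s′ t′ q) →-dec
     (s ≟ s′) ×-dec (t ≟ t′))
  ×-dec (Fin.all? λ p → Fin.all? λ s → Fin.all? λ i → Fin.any? λ t → cell s t p ≟ i)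
  ×-dec (Fin.all? λ p → Fin.all? λ s → Fin.all? λ t → Fin.all? λ t′ →
     (cell s t p ≟ cell s t′ p) →-dec (t ≟ t′)))

record Latin : Set where
  constructor latin
  field
    cell  : Square
    isLat : IsLatin cell
  open IsLatin isLat public

open Latin using (cell)

-- sumZero and sumOne are {i + j + k = 0} and {i + j + k = 1}, while addition₂ is {k = i + j} and
-- addition₀ is {i = j + k}.
sumZero sumOne addition₂ addition₀ : Square
sumZero s t p = t ⊕ p ⊗ s
sumOne s t 2F = suc₃ (sumZero s t 2F)
sumOne s t p  = sumZero s t p
addition₂ s t 0F = t
addition₂ s t 1F = t ⊕ s
addition₂ s t 2F = t ⊕ (t ⊕ s)
addition₀ s t 0F = t ⊕ (t ⊕ s)
addition₀ s t 1F = t ⊕ s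
addition₀ s t 2F = t

sumZero-latin sumOne-latin addition₂-latin addition₀-latin : Latin
sumZero-latin   = latin sumZero (from-yes (isLatin? sumZero))
sumOne-latin    = latin sumOne (from-yes (isLatin? sumOne))
addition₂-latin = latin addition₂ (from-yes (isLatin? addition₂))
addition₀-latin = latin addition₀ (from-yes (isLatin? addition₀))

-- The tripling construction

module Tripling {A : Set} (_≟ᴬ_ : DecidableEquality A) (points : Enumeration A)
                (K : Kirkman A) (lat : ∀ r → Kirkman.Block K r → Latin) where
  open Kirkman K

  -- `nothing` is the class of vertical blocks; `just (r , s)` joins the classes `s` of the designs
  -- over the blocks of `r`.
  Class₃ : Set
  Class₃ = Maybe (Class × Fin 3)

  Block₃ : Class₃ → Set
  Block₃ nothing        = A
  Block₃ (just (r , s)) = Block r × Fin 3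

  block₃ : ∀ r → Block₃ r → Fin 3 → A × Fin 3
  block₃ nothing        x       p = x , p
  block₃ (just (r , s)) (b , t) p = block r b p , cell (lat r b) s t p

  blocks₃ : ∀ r → Enumeration (Block₃ r)
  blocks₃ nothing        = points
  blocks₃ (just (r , s)) = ×-enumeration (blocks r) (Fin-enumeration 3)

  proper₃ : ∀ r b {p q} → block₃ r b p ≡ block₃ r b q → p ≡ q
  proper₃ nothing        x       eq = cong proj₂ eq
  proper₃ (just (r , s)) (b , t) eq = proper r b (cong proj₁ eq)

  pair₃ : ∀ {x y} → x ≢ y →
          ∃! _≡_ λ ((r , b) : Σ Class₃ Block₃) → block₃ r b ∋ x × block₃ r b ∋ y
  pair₃ {x , i} {y , j} xi≢yj with x ≟ᴬ y
  ... | yes refl = (nothing , x) , ((i , refl) , (j , refl)) , unique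
    where
    unique : ∀ {rb} → block₃ (proj₁ rb) (proj₂ rb) ∋ (x , i) × block₃ (proj₁ rb) (proj₂ rb) ∋ (x , j) →
             (nothing , x) ≡ rb
    unique {nothing , _} ((_ , refl) , _) = refl
    unique {just (r , s) , (b , t)} ((p , eq) , (q , eq′))
      with refl ← proper r b (cong proj₁ (trans eq (cong (_, i) (sym (cong proj₁ eq′))))) =
      contradiction (trans (sym eq) eq′) xi≢yj
  -- Projection to `A` fixes the base block; `meet` and `determined` then give and fix the triple
  -- over it.
  ... | no x≢y with (r , b) , ((p , refl) , (q , refl)) , unique ← pair x≢y =
    let s , t , eqᵢ , eqⱼ = meet p q i j p≢q
    in (just (r , s) , (b , t)) , ((p , cong (_ ,_) eqᵢ) , (q , cong (_ ,_) eqⱼ)) , unique₃ eqᵢ eqⱼ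
    where
    open Latin (lat r b)
    p≢q : p ≢ q
    p≢q = x≢y ∘ cong (block r b)
    unique₃ : ∀ {s t} → cell (lat r b) s t p ≡ i → cell (lat r b) s t q ≡ j → ∀ {rb} →
              block₃ (proj₁ rb) (proj₂ rb) ∋ (block r b p , i) ×
              block₃ (proj₁ rb) (proj₂ rb) ∋ (block r b q , j) →
              (just (r , s) , (b , t)) ≡ rb
    unique₃ _ _ {nothing , _} ((_ , eq) , (_ , eq′)) =
      contradiction (trans (sym (cong proj₁ eq)) (cong proj₁ eq′)) x≢y
    unique₃ {s} {t} eqᵢ eqⱼ {just (_ , s′) , (_ , t′)} ((p′ , eq) , (q′ , eq′))
      with refl ← unique ((p′ , cong proj₁ eq) , (q′ , cong proj₁ eq′))
      with refl ← proper r b (cong proj₁ eq) | refl ← proper r b (cong proj₁ eq′)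
      with refl , refl ← determined p q s t s′ t′ p≢q
             (trans eqᵢ (sym (cong proj₂ eq))) (trans eqⱼ (sym (cong proj₂ eq′))) = refl

  parallel₃ : ∀ r x → ∃! _≡_ λ b → block₃ r b ∋ x
  parallel₃ nothing        (x , i) = x , (i , refl) , λ { (_ , refl) → refl }
  parallel₃ (just (r , s)) (x , i) with b , (p , refl) , unique ← parallel r x =
    let t , eqᵢ = resolve p s i in (b , t) , (p , cong (_ ,_) eqᵢ) , unique₃ eqᵢ
    where
    open Latin (lat r b)
    unique₃ : ∀ {t} → cell (lat r b) s t p ≡ i → ∀ {bt} →
              block₃ (just (r , s)) bt ∋ (block r b p , i) → (b , t) ≡ bt
    unique₃ {t} eqᵢ {_ , t′} (p′ , eq)
      with refl ← unique (p′ , cong proj₁ eq)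
      with refl ← proper r b (cong proj₁ eq)
      with refl ← resolved p s t t′ (trans eqᵢ (sym (cong proj₂ eq))) = refl

  tripled : Kirkman (A × Fin 3)
  tripled = record
    { Class = Class₃ ; Block = Block₃
    ; classes = Maybe-enumeration (×-enumeration classes (Fin-enumeration 3))
    ; blocks = blocks₃ ; block = block₃
    ; proper = proper₃ ; pair = pair₃ ; parallel = parallel₃ }

-- Colour focusing

-- `_∙_` completes two points to a line. Total and idempotent, it can be taken componentwise in
-- products; `closed` ties it to the blocks.
record Space : Set₁ where
  field
    Point   : Set
    size    : ℕ
    finite  : Point ↔ Fin size
    kirkman : Kirkman Point
    _∙_     : Point → Point → Point
    idem    : ∀ x → x ∙ x ≡ x
  open Kirkman kirkman public
  field
    closed  : ∀ r b p q → block r b p ∙ block r b q ≡ block r b (third p q)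

  points : Enumeration Point
  points = ↔-enumeration finite (Fin-enumeration size)

  _≟ᴾ_ : DecidableEquality Point
  x ≟ᴾ y = map′ (λ eq → trans (sym (strictlyInverseʳ x)) (trans (cong from eq) (strictlyInverseʳ y)))
                (cong to) (to x ≟ to y)
    where open Inverse finite

  LineFree : ∀ {k} → (Point → Fin k) → Set
  LineFree f = ∀ {x y} → x ≢ y → f x ≡ f y → f x ≢ f (x ∙ y)

covers : ∀ p q u → p ≢ q → u ≡ p ⊎ u ≡ q ⊎ u ≡ third p q
covers = from-yes (Fin.all? λ p → Fin.all? λ q → Fin.all? λ u →
  ¬? (p ≟ q) →-dec ((u ≟ p) ⊎-dec (u ≟ q) ⊎-dec (u ≟ third p q)))

proper⇒lineFree : ∀ S {k} {f : Space.Point S → Fin k} → Proper (Space.kirkman S) f → Space.LineFree S f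
proper⇒lineFree S {f = f} prop x≢y eq eq′ with Space.pair S x≢y
... | (r , b) , ((p , refl) , (q , refl)) , _ =
  prop r b λ u v → trans (at u) (sym (at v))
  where
  open Space S
  at : ∀ u → f (block r b u) ≡ f (block r b p)
  at u with covers p q u (x≢y ∘ cong (block r b))
  ... | inj₁ refl        = refl
  ... | inj₂ (inj₁ refl) = sym eq
  ... | inj₂ (inj₂ refl) = trans (cong f (sym (closed r b p q))) (sym eq′)

×3-finite : ∀ {A : Set} {n} → A ↔ Fin n → (A × Fin 3) ↔ Fin (n * 3)
×3-finite A↔n = ↔-trans (A↔n ×-↔ ↔-refl) (↔-sym Fin.*↔×)

third-idem : ∀ i → third i i ≡ i
third-idem = from-yes (Fin.all? λ i → third i i ≟ i)

-- `sumZero s t` is the affine map `p ↦ t + p s`, and affine maps preserve collinearity. Hence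
-- `thrice` uses this square over every block.
sumZero-closed : ∀ s t p q → third (sumZero s t p) (sumZero s t q) ≡ sumZero s t (third p q)
sumZero-closed = from-yes (Fin.all? λ s → Fin.all? λ t → Fin.all? λ p → Fin.all? λ q →
  third (sumZero s t p) (sumZero s t q) ≟ sumZero s t (third p q))

thrice : Space → Space
thrice S = record
  { Point = Point × Fin 3
  ; size = size * 3
  ; finite = ×3-finite finite
  ; kirkman = Tripling.tripled _≟ᴾ_ points kirkman (λ _ _ → sumZero-latin)
  ; _∙_ = λ (x , i) (y , j) → (x ∙ y) , third i j
  ; idem = λ (x , i) → cong₂ _,_ (idem x) (third-idem i)
  ; closed = closed₃ }
  where
  open Space S
  open Tripling _≟ᴾ_ points kirkman (λ _ _ → sumZero-latin) using (block₃)
  closed₃ : ∀ r b p q → _ ≡ block₃ r b (third p q)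
  closed₃ nothing        x       p q = cong (_, _) (idem x)
  closed₃ (just (r , s)) (b , t) p q = cong₂ _,_ (closed r b p q) (sumZero-closed s t p q)

power : ℕ → Space → Space
power zero    S = S
power (suc M) S = thrice (power M S)

size-power : ∀ M S → Space.size S ≤ Space.size (power M S)
size-power zero    S = ℕ.≤-refl
size-power (suc M) S = ℕ.≤-trans (size-power M S) (ℕ.m≤m*n _ 3)

module _ (S : Space) where
  open Space

  -- power M S is the product of S with AG(M,3); embed v is the copy of S over the point v.
  embed : ∀ {M} → (Fin M → Fin 3) → Point S → Point (power M S)
  embed {zero}  v x = x
  embed {suc M} v x = embed (v ∘ suc) x , v zero

  embed-injectiveˡ : ∀ {M} {v w : Fin M → Fin 3} {x y} → embed v x ≡ embed w y → ∀ i → v i ≡ w i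
  embed-injectiveˡ {suc M} eq zero    = cong proj₂ eq
  embed-injectiveˡ {suc M} eq (suc i) = embed-injectiveˡ (cong proj₁ eq) i

  embed-injectiveʳ : ∀ {M} {v w : Fin M → Fin 3} {x y} → embed v x ≡ embed w y → x ≡ y
  embed-injectiveʳ {zero}  eq = eq
  embed-injectiveʳ {suc M} eq = embed-injectiveʳ (cong proj₁ eq)

  embed-cong : ∀ {M} {v w : Fin M → Fin 3} {x} → (∀ i → v i ≡ w i) → embed v x ≡ embed w x
  embed-cong {zero}  v≗w = refl
  embed-cong {suc M} v≗w = cong₂ _,_ (embed-cong (v≗w ∘ suc)) (v≗w zero)

  embed-∙ : ∀ {M} (v w : Fin M → Fin 3) x y →
            _∙_ (power M S) (embed v x) (embed w y) ≡ embed (λ i → third (v i) (w i)) (_∙_ S x y)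
  embed-∙ {zero}  v w x y = refl
  embed-∙ {suc M} v w x y = cong (_, _) (embed-∙ (v ∘ suc) (w ∘ suc) x y)

  lineFree-embed : ∀ {M k} {f : Point (power M S) → Fin k} (v : Fin M → Fin 3) →
                   LineFree (power M S) f → LineFree S (f ∘ embed v)
  lineFree-embed {f = f} v free {x} {y} x≢y eq eq′ = free (x≢y ∘ embed-injectiveʳ) eq
    (trans eq′ (cong f (sym (trans (embed-∙ v v x y) (embed-cong (third-idem ∘ v))))))

  -- r monochromatic pairs, in distinct colours, whose lines all pass through the focus.
  record Focus {k} (f : Point S → Fin k) (r : ℕ) : Set where
    field
      focus      : Point S
      left right : Fin r → Point S
      apart      : ∀ i → left i ≢ right i
      meets      : ∀ i → _∙_ S (left i) (right i) ≡ focus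
      same       : ∀ i → f (left i) ≡ f (right i)
      spread     : ∀ {i j} → f (left i) ≡ f (left j) → i ≡ j

  focused⇒¬proper : ∀ {k} → (∀ (f : Point S → Fin k) → LineFree S f → Focus f (suc k)) →
                    ∀ (f : Point S → Fin k) → ¬ Proper (kirkman S) f
  focused⇒¬proper focused f prop
    with F ← focused f (proper⇒lineFree S prop)
    with i , j , i<j , eq ← Fin.pigeonhole (ℕ.n<1+n _) (f ∘ Focus.left F) =
    Fin.<⇒≢ i<j (Focus.spread F eq)

-- The standard basis: `M` distinct levels of AG(M,3), already indexed by `Fin M` for the pigeonhole
-- principle.
unit : ∀ {M} → Fin M → Fin M → Fin 3
unit j i with j ≟ i
... | yes _ = 1F
... | no  _ = 0F

unit-injective : ∀ {M} {j j′ : Fin M} → (∀ i → unit j i ≡ unit j′ i) → j ≡ j′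
unit-injective {j = j} {j′} eq with j ≟ j | j′ ≟ j | eq j
... | no j≢j | _       | _  = contradiction refl j≢j
... | yes _  | yes j′≡j | _ = sym j′≡j
... | yes _  | no _    | ()

-- `S` has `k ^ size` colourings, so among one more level than that, two are coloured alike.
refocus : ∀ S {k r} → (∀ (f : Space.Point S → Fin k) → Space.LineFree S f → Focus S f r) →
          let S′ = power (suc (k ^ Space.size S)) S in
          ∀ (f : Space.Point S′ → Fin k) → Space.LineFree S′ f → Focus S′ f (suc r)
refocus S {k} {r} focused f free
  with j , j′ , j<j′ , eq ← Fin.pigeonhole (ℕ.n<1+n _)
         (λ j → funToFin (f ∘ embed S (unit j) ∘ Inverse.from (Space.finite S))) =
  record
    { focus  = embed S w focus
    -- Index `zero` is the new pair, the old focus on both levels. Each old pair is split: its left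
    -- point goes to level `u`, its right point to `u′`.
    ; left   = λ { zero → u focus ; (suc i) → u (left i) }
    ; right  = λ { zero → u′ focus ; (suc i) → u′ (right i) }
    ; apart  = λ { zero → u≢u′ ; (suc i) → u≢u′ }
    ; meets  = λ { zero    → u∙u′ focus focus (idem focus)
                 ; (suc i) → u∙u′ (left i) (right i) (meets i) }
    ; same   = λ { zero → u≈u′ focus ; (suc i) → trans (same i) (u≈u′ (right i)) }
    ; spread = λ { {zero}  {zero}  eq → refl
                 ; {zero}  {suc i} eq → contradiction (sym eq) (left≢focus i)
                 ; {suc i} {zero}  eq → contradiction eq (left≢focus i)
                 ; {suc i} {suc j} eq → cong suc (spread eq) } }
  where
  open Space S
  open Inverse finite
  u u′ : Point → Space.Point (power (suc (k ^ size)) S)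
  u  = embed S (unit j)
  u′ = embed S (unit j′)
  w : _ → Fin 3
  w i = third (unit j i) (unit j′ i)
  free-u : LineFree (f ∘ u)
  free-u = lineFree-embed S (unit j) free
  open Focus (focused (f ∘ u) free-u)
  u≢u′ : ∀ {x y} → u x ≢ u′ y
  u≢u′ eq = Fin.<⇒≢ j<j′ (unit-injective (embed-injectiveˡ S eq))
  u∙u′ : ∀ x y {z} → x ∙ y ≡ z → Space._∙_ (power (suc (k ^ size)) S) (u x) (u′ y) ≡ embed S w z
  u∙u′ x y eq = trans (embed-∙ S (unit j) (unit j′) x y) (cong (embed S w) eq)
  u≈u′ : ∀ x → f (u x) ≡ f (u′ x)
  u≈u′ x = begin
    f (u x)                                 ≡⟨ cong (f ∘ u) (strictlyInverseʳ x) ⟨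
    f (u (from (to x)))                     ≡⟨ Fin.finToFun-funToFin (f ∘ u ∘ from) (to x) ⟨
    finToFun (funToFin (f ∘ u ∘ from)) (to x)  ≡⟨ cong (λ h → finToFun h (to x)) eq ⟩
    finToFun (funToFin (f ∘ u′ ∘ from)) (to x) ≡⟨ Fin.finToFun-funToFin (f ∘ u′ ∘ from) (to x) ⟩
    f (u′ (from (to x)))                    ≡⟨ cong (f ∘ u′) (strictlyInverseʳ x) ⟩
    f (u′ x)                                ∎
    where open ≡-Reasoning
  -- Otherwise an old pair and its focus would form a monochromatic line within level `u`.
  left≢focus : ∀ i → f (u (left i)) ≢ f (u focus)
  left≢focus i eq = free-u (apart i) (same i) (trans eq (cong (f ∘ u) (sym (meets i))))

singleton : Space
singleton = record
  { Point = ⊤ ; size = 1 ; finite = ↔-sym Fin.1↔⊤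
  ; kirkman = record
    { Class = ⊥ ; Block = λ () ; classes = ⊥-enumeration ; blocks = λ () ; block = λ ()
    ; proper = λ () ; pair = λ x≢y → contradiction refl x≢y ; parallel = λ () }
  ; _∙_ = λ _ _ → tt ; idem = λ _ → refl ; closed = λ () }

size-power-singleton : ∀ m → m < Space.size (power m singleton)
size-power-singleton zero    = s≤s z≤n
size-power-singleton (suc m) = ℕ.<-≤-trans (s≤s (size-power-singleton m)) (ℕ.m<m*n _ 3 (s≤s (s≤s z≤n)))
  where instance _ = >-nonZero (ℕ.≤-<-trans z≤n (size-power-singleton m))

-- Induction on `r`. The base case has `3 ^ m` points and no pairs; the bound `m` survives because
-- `refocus` only enlarges the space.
large-focused : ∀ k m r → Σ Space λ S → m ≤ Space.size S ×
                (∀ (f : Space.Point S → Fin k) → Space.LineFree S f → Focus S f r)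
large-focused k m zero = power m singleton , ℕ.<⇒≤ (size-power-singleton m) , λ f _ → record
  { focus = embed singleton {m} (λ _ → 0F) tt
  ; left = λ () ; right = λ () ; apart = λ () ; meets = λ () ; same = λ () ; spread = λ { {()} } }
large-focused k m (suc r) with S , m≤ , focused ← large-focused k m r =
  power (suc (k ^ Space.size S)) S ,
  ℕ.≤-trans m≤ (size-power (suc (k ^ Space.size S)) S) ,
  refocus S focused

-- Critical colourings

-- Functions are searched through their codes in a finite type. Decoding recovers a function only
-- pointwise, so `P` has to respect pointwise equality.
decide-∃-fun : ∀ {A : Set} {n k} → A ↔ Fin n → {P : (A → Fin k) → Set} →
               (∀ {f g} → (∀ x → f x ≡ g x) → P f → P g) → (∀ f → Dec (P f)) → Dec (∃ P)
decide-∃-fun A↔n resp P? = map′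
  (λ (i , p) → -, p)
  (λ (f , p) → funToFin (f ∘ from) , resp (λ x → sym (trans
     (Fin.finToFun-funToFin (f ∘ from) (to x)) (cong f (strictlyInverseʳ x)))) p)
  (Fin.any? λ i → P? (finToFun i ∘ to))
  where open Inverse A↔n

module _ {A I : Set} {n : ℕ} (A↔n : A ↔ Fin n) (_≟ᴬ_ : DecidableEquality A)
         (B : I → Fin 3 → A) (inj : ∀ i {p q} → B i p ≡ B i q → p ≡ q) where

  Colours : ∀ {k} → (A → Fin k) → List I → Set
  Colours f = All (λ i → ¬ Monochromatic (f ∘ B i))

  colourable? : ∀ k is → Dec (∃ λ (f : A → Fin k) → Colours f is)
  colourable? k is = decide-∃-fun A↔n
    (λ f≗g → All.map λ ¬mono mono → ¬mono λ p q → trans (f≗g _) (trans (mono p q) (sym (f≗g _))))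
    (λ f → All.all? (λ i → ¬? (monochromatic? (f ∘ B i))) is)

  recolour : ∀ {k} → A → (A → Fin k) → A → Fin (suc k)
  recolour x f y with y ≟ᴬ x
  ... | yes _ = fromℕ _
  ... | no  _ = inject₁ (f y)

  recolour-≡ : ∀ {k} x (f : A → Fin k) → recolour x f x ≡ fromℕ k
  recolour-≡ x f with x ≟ᴬ x
  ... | yes _  = refl
  ... | no x≢x = contradiction refl x≢x

  recolour-≢ : ∀ {k} x (f : A → Fin k) {y} → y ≢ x → recolour x f y ≡ inject₁ (f y)
  recolour-≢ x f {y} y≢x with y ≟ᴬ x
  ... | yes y≡x = contradiction y≡x y≢x
  ... | no  _   = refl

  other : ∀ (p : Fin 3) → ∃ λ q → q ≢ p
  other 0F = 1F , λ ()
  other 1F = 0F , λ ()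
  other 2F = 0F , λ ()

  -- The new colour sits at `x` alone, so every block through `x`, `i` among them, gets two colours.
  -- Other blocks keep theirs up to `inject₁`.
  recolour-proper : ∀ {k i is} {f : A → Fin k} → Colours f is →
                    Colours (recolour (B i 0F) f) (i ∷ is)
  recolour-proper {i = i} {is} {f} col = All.tabulate ¬mono
    where
    x = B i 0F
    ¬mono : ∀ {j} → j ∈ i ∷ is → ¬ Monochromatic (recolour x f ∘ B j)
    ¬mono {j} j∈ mono with Fin.any? (λ p → B j p ≟ᴬ x)
    ¬mono {j} j∈ mono | yes (p , eq) with q , q≢p ← other p = Fin.fromℕ≢inject₁
      (trans (sym (recolour-≡ x f)) (trans (cong (recolour x f) (sym eq))
        (trans (mono p q) (recolour-≢ x f λ eq′ → q≢p (inj j (trans eq′ (sym eq)))))))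
    ¬mono (here refl) mono | no ∌x = ∌x (0F , refl)
    ¬mono (there j∈)  mono | no ∌x = All.lookup col j∈ λ p q → Fin.inject₁-injective
      (trans (sym (recolour-≢ x f (∌x ∘ (p ,_)))) (trans (mono p q) (recolour-≢ x f (∌x ∘ (q ,_)))))

  -- `c` may leave blocks monochromatic; the remaining ones must already exclude a colouring with
  -- one colour fewer.
  Critical : ∀ {k} → (A → Fin (suc k)) → Set
  Critical {k} c = ∀ (g : A → Fin k) →
    ¬ (∀ i → ¬ Monochromatic (c ∘ B i) → ¬ Monochromatic (g ∘ B i))

  -- The shortest suffix of the list that is not (suc k)-colourable becomes colourable once one point
  -- of its first block is given an additional colour.
  colouring⊎critical : ∀ {k} is → (∃ λ (f : A → Fin (suc k)) → Colours f is) ⊎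
                                  (∃ λ (c : A → Fin (suc (suc k))) → Critical c)
  colouring⊎critical [] = inj₁ ((λ _ → zero) , [])
  colouring⊎critical (i ∷ is) with colouring⊎critical is
  ... | inj₂ critical  = inj₂ critical
  ... | inj₁ (f , col) with colourable? _ (i ∷ is)
  ...   | yes colourable = inj₁ colourable
  ...   | no ¬colourable = inj₂ (recolour (B i 0F) f , λ g keeps →
            ¬colourable (g , All.map (keeps _) (recolour-proper col)))

critical-colouring : ∀ S {k} → (∀ (f : Space.Point S → Fin (suc k)) → ¬ Proper (Space.kirkman S) f) →
                     ∃ λ (c : Space.Point S → Fin (suc (suc k))) →
                       Critical (Space.finite S) (Space._≟ᴾ_ S)
                         (uncurry (Space.block S)) (uncurry (Space.proper S)) c
critical-colouring S uncolourable
  with colouring⊎critical finite _≟ᴾ_ (uncurry block) (uncurry proper)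
         (concatMap (λ r → map (r ,_) (blocks r .elements)) (classes .elements))
  where open Space S
... | inj₂ critical  = critical
... | inj₁ (f , col) = contradiction
  (λ r b → All.lookup col (∈-concatMap⁺ _
     (Any.map (λ { refl → ∈-map⁺ _ (one⇒any (blocks r .once b)) }) (one⇒any (classes .once r)))))
  (uncolourable f)
  where open Space S

-- Rotating the colours along the levels

-- The cyclic shift `a - 1` modulo `suc n`.
rotate : ∀ {n} → Fin (suc n) → Fin (suc n)
rotate zero    = fromℕ _
rotate (suc i) = inject₁ i

rotate-injective : ∀ {n} {a b : Fin (suc n)} → rotate a ≡ rotate b → a ≡ b
rotate-injective {a = zero}  {zero}  eq = refl
rotate-injective {a = zero}  {suc b} eq = contradiction eq Fin.fromℕ≢inject₁
rotate-injective {a = suc a} {zero}  eq = contradiction (sym eq) Fin.fromℕ≢inject₁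
rotate-injective {a = suc a} {suc b} eq = cong suc (Fin.inject₁-injective eq)

inject₁≢suc : ∀ {n} (i : Fin n) → inject₁ i ≢ suc i
inject₁≢suc (suc i) eq = inject₁≢suc i (Fin.suc-injective eq)

inject₁²≢suc² : ∀ {n} (i : Fin n) → inject₁ (inject₁ i) ≢ suc (suc i)
inject₁²≢suc² (suc i) eq = inject₁²≢suc² i (Fin.suc-injective eq)

inject₁³≢suc³ : ∀ {n} (i : Fin n) → inject₁ (inject₁ (inject₁ i)) ≢ suc (suc (suc i))
inject₁³≢suc³ (suc i) eq = inject₁³≢suc³ i (Fin.suc-injective eq)

module _ {d : ℕ} where
  private Colour = Fin (4 + d)

  rotate¹≢ : (a : Colour) → rotate a ≢ a
  rotate¹≢ (suc a) = inject₁≢suc a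

  rotate²≢ : (a : Colour) → rotate (rotate a) ≢ a
  rotate²≢ (suc (suc a)) = inject₁²≢suc² a

  -- Four colours are essential here: on three, `rotate` is a 3-cycle. For the small `a` without a
  -- clause, the two sides evaluate to different constructors.
  rotate³≢ : (a : Colour) → rotate (rotate (rotate a)) ≢ a
  rotate³≢ (suc (suc (suc a))) = inject₁³≢suc³ a

  turn : Fin 3 → Colour → Colour
  turn 0F a = a
  turn 1F a = rotate a
  turn 2F a = rotate (rotate a)

  turn-injectiveʳ : ∀ i {a b} → turn i a ≡ turn i b → a ≡ b
  turn-injectiveʳ 0F = id
  turn-injectiveʳ 1F = rotate-injective
  turn-injectiveʳ 2F = rotate-injective ∘ rotate-injective

  turn-injectiveˡ : ∀ i j {a} → turn i a ≡ turn j a → i ≡ j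
  turn-injectiveˡ 0F 0F eq = refl
  turn-injectiveˡ 1F 1F eq = refl
  turn-injectiveˡ 2F 2F eq = refl
  turn-injectiveˡ 0F 1F eq = contradiction (sym eq) (rotate¹≢ _)
  turn-injectiveˡ 1F 0F eq = contradiction eq (rotate¹≢ _)
  turn-injectiveˡ 0F 2F eq = contradiction (sym eq) (rotate²≢ _)
  turn-injectiveˡ 2F 0F eq = contradiction eq (rotate²≢ _)
  turn-injectiveˡ 1F 2F eq = contradiction (sym eq) (rotate¹≢ _)
  turn-injectiveˡ 2F 1F eq = contradiction eq (rotate¹≢ _)

  Turned : (Fin 3 → Colour) → (Fin 3 → Fin 3) → Set
  Turned col ρ = Monochromatic (λ p → turn (ρ p) (col p))

  -- Turns by 0, 1 and 2 steps send a colour to three different colours. Together with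
  -- `turned-colour`: in a monochromatic triple, two levels agree exactly when the base colours do.
  turned-level : ∀ col ρ → Turned col ρ → ∀ {p q} → col p ≡ col q → ρ p ≡ ρ q
  turned-level col ρ mono {p} {q} eq =
    turn-injectiveˡ (ρ p) (ρ q) (trans (mono p q) (cong (turn (ρ q)) (sym eq)))

  turned-colour : ∀ col ρ → Turned col ρ → ∀ {p q} → ρ p ≡ ρ q → col p ≡ col q
  turned-colour col ρ mono {p} {q} eq =
    turn-injectiveʳ (ρ p) (trans (mono p q) (cong (λ i → turn i (col q)) (sym eq)))

  -- The second condition keeps a level 0 copy of each non-monochromatic block, for the lower bound.
  Separates : (Fin 3 → Colour) → Latin → Set
  Separates col L = (∀ s t → ¬ Turned col (cell L s t)) ×
                    (¬ Monochromatic col → ∀ p → cell L 0F 0F p ≡ 0F)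

  sumOne-nonconstant : ∀ s t → ¬ Monochromatic (sumOne s t)
  sumOne-nonconstant = from-yes (Fin.all? λ s → Fin.all? λ t → ¬? (monochromatic? (sumOne s t)))

  -- Modulo 3, `i + i + k = 0` gives `k = i`.
  sumZero-constant : ∀ s t p q → p ≢ q → sumZero s t p ≡ sumZero s t q → Monochromatic (sumZero s t)
  sumZero-constant = from-yes (Fin.all? λ s → Fin.all? λ t → Fin.all? λ p → Fin.all? λ q →
    ¬? (p ≟ q) →-dec (sumZero s t p ≟ sumZero s t q) →-dec monochromatic? (sumZero s t))

  injective? : (ρ : Fin 3 → Fin 3) → Dec (∀ p q → ρ p ≡ ρ q → p ≡ q)
  injective? ρ = Fin.all? λ p → Fin.all? λ q → (ρ p ≟ ρ q) →-dec (p ≟ q)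

  -- With `k = i + j`, a zero at `i` or `j` would make the other two levels equal, so distinct
  -- levels put 0 at position 2.
  addition₂-permutation : ∀ s t → let ρ = addition₂ s t in (∀ p q → ρ p ≡ ρ q → p ≡ q) →
                          ρ 2F ≡ 0F × (ρ 0F ≡ 1F × ρ 1F ≡ 2F ⊎ ρ 0F ≡ 2F × ρ 1F ≡ 1F)
  addition₂-permutation = from-yes (Fin.all? λ s → Fin.all? λ t → let ρ = addition₂ s t in
    injective? ρ →-dec (ρ 2F ≟ 0F) ×-dec
      ((ρ 0F ≟ 1F) ×-dec (ρ 1F ≟ 2F) ⊎-dec (ρ 0F ≟ 2F) ×-dec (ρ 1F ≟ 1F)))

  addition₀-permutation : ∀ s t → let ρ = addition₀ s t in (∀ p q → ρ p ≡ ρ q → p ≡ q) →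
                          ρ 0F ≡ 0F × (ρ 2F ≡ 1F × ρ 1F ≡ 2F ⊎ ρ 2F ≡ 2F × ρ 1F ≡ 1F)
  addition₀-permutation = from-yes (Fin.all? λ s → Fin.all? λ t → let ρ = addition₀ s t in
    injective? ρ →-dec (ρ 0F ≟ 0F) ×-dec
      ((ρ 2F ≟ 1F) ×-dec (ρ 1F ≟ 2F) ⊎-dec (ρ 2F ≟ 2F) ×-dec (ρ 1F ≟ 1F)))

  -- Over these levels, a monochromatic triple has consecutive colours of the rotation below it, the
  -- last of them at the point on level 0.
  turned-chain : ∀ col ρ x y z → Turned col ρ →
                 ρ z ≡ 0F × (ρ x ≡ 1F × ρ y ≡ 2F ⊎ ρ x ≡ 2F × ρ y ≡ 1F) →
                 (rotate (col y) ≡ col x × rotate (col x) ≡ col z) ⊎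
                 (rotate (col x) ≡ col y × rotate (col y) ≡ col z)
  turned-chain col ρ x y z mono (z0 , levels) = [ inj₁ ∘ chain y x , inj₂ ∘ chain x y ∘ swap ]′ levels
    where
    at : ∀ p q {i j} → ρ p ≡ i → ρ q ≡ j → turn i (col p) ≡ turn j (col q)
    at p q refl refl = mono p q
    chain : ∀ u v → ρ v ≡ 1F × ρ u ≡ 2F → rotate (col u) ≡ col v × rotate (col v) ≡ col z
    chain u v (v1 , u2) = rotate-injective (at u v u2 v1) , at v z v1 z0

  separate : ∀ col → Σ Latin (Separates col)
  separate col with monochromatic? col
  ... | yes mono = sumOne-latin ,
    (λ s t turned → sumOne-nonconstant s t λ p q → turned-level col (sumOne s t) turned (mono p q)) ,
    contradiction mono
  ... | no ¬mono with Fin.any? (λ p → Fin.any? λ q → ¬? (p ≟ q) ×-dec (col p ≟ col q))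
  -- Equal colours at `p` and `q` force equal levels there, hence everywhere, and so a monochromatic
  -- base block.
  ...   | yes (p , q , p≢q , eq) = sumZero-latin ,
    (λ s t turned → ¬mono λ u v → turned-colour col (sumZero s t) turned
       (sumZero-constant s t p q p≢q (turned-level col (sumZero s t) turned eq) u v)) ,
    λ _ → from-yes (Fin.all? λ p → sumZero 0F 0F p ≟ 0F)
  -- For three distinct colours, `addition₀` works whenever `addition₂` fails.
  ...   | no ¬repeated
    with Fin.any? (λ s → Fin.any? λ t → monochromatic? λ p → turn (addition₂ s t p) (col p))
  ...     | no ¬turned = addition₂-latin , (λ s t turned → ¬turned (s , t , turned)) ,
    λ _ → from-yes (Fin.all? λ p → addition₂ 0F 0F p ≟ 0F)
  ...     | yes (s , t , turned) = addition₀-latin , no-turned ,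
    λ _ → from-yes (Fin.all? λ p → addition₀ 0F 0F p ≟ 0F)
    where
    repeated : ∀ {p q} → p ≢ q → col p ≢ col q
    repeated p≢q eq = ¬repeated (-, -, p≢q , eq)
    level-injective : ∀ ρ → Turned col ρ → ∀ p q → ρ p ≡ ρ q → p ≡ q
    level-injective ρ turned p q eq with p ≟ q
    ... | yes p≡q = p≡q
    ... | no  p≢q = contradiction (turned-colour col ρ turned eq) (repeated p≢q)
    cycle : ∀ {a b c : Colour} → rotate a ≡ b → rotate b ≡ c → rotate c ≢ a
    cycle refl refl = rotate³≢ _
    no-turned : ∀ s′ t′ → ¬ Turned col (addition₀ s′ t′)
    -- One chain of colours ends at position 2, the other at position 0. Together they identify the
    -- colours of these positions or close a 3-cycle.
    no-turned s′ t′ turned′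
      with turned-chain col (addition₂ s t) 0F 1F 2F turned
             (addition₂-permutation s t (level-injective (addition₂ s t) turned))
         | turned-chain col (addition₀ s′ t′) 2F 1F 0F turned′
             (addition₀-permutation s′ t′ (level-injective (addition₀ s′ t′) turned′))
    ... | inj₁ (ba , ac) | inj₁ (bc , _)  = repeated {0F} {2F} (λ ()) (trans (sym ba) bc)
    ... | inj₁ (ba , ac) | inj₂ (cb , _)  = cycle ba ac cb
    ... | inj₂ (ab , bc) | inj₁ (_  , ca) = cycle ab bc ca
    ... | inj₂ (ab , bc) | inj₂ (_  , ba) = repeated {0F} {2F} (λ ()) (trans (sym ba) bc)

theorem5p7 : (δ : ℕ) → δ ≥ 4 →
    (m : ℕ) → Σ ℕ (λ n → (n ≥ m) × Σ (KTS n) (λ K → KTSChromatic K δ))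
theorem5p7 (suc (suc (suc (suc d)))) (s≤s (s≤s (s≤s (s≤s z≤n)))) m
  -- A focus with `4 + d` pairs excludes `3 + d` colours; the critical colouring then uses `4 + d`,
  -- which is δ.
  with S , m≤ , focused ← large-focused (3 + d) m (4 + d)
  with c , critical ← critical-colouring S (focused⇒¬proper S focused) =
  size * 3 , ℕ.≤-trans m≤ (ℕ.m≤m*n size 3) , kts ,
  (-, proper⇒isColouring {f = λ (x , i) → turn i (c x)} colouring) , lower
  where
  open Space S
  L : ∀ r b → Latin
  L r b = proj₁ (separate (c ∘ block r b))
  open Tripling _≟ᴾ_ points kirkman L using (tripled)
  open ToKTS (×3-finite finite) tripled

  colouring : Proper tripled (λ (x , i) → turn i (c x))
  colouring nothing        x       mono = contradiction (turn-injectiveˡ 0F 1F (mono 0F 1F)) λ ()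
  colouring (just (r , s)) (b , t) mono = proj₁ (proj₂ (separate (c ∘ block r b))) s t mono

  lower : ∀ k → k < 4 + d → ¬ Colourable (concat classList) k
  lower k (s≤s k≤) (f , col) =
    -- Fewer than δ colours fit into `3 + d`. The level 0 copy of a block that `c` does not make
    -- monochromatic is the triple with `s` and `t` both `0F`, so the restriction to level 0
    -- contradicts criticality.
    critical (λ x → inject≤ (f₃ (x , 0F)) k≤) λ (r , b) ¬mono mono →
      isColouring⇒proper col (just (r , 0F)) (b , 0F) λ p q →
        trans (level r b ¬mono p) (trans (Fin.inject≤-injective k≤ k≤ _ _ (mono p q))
              (sym (level r b ¬mono q)))
    where
    f₃ = f ∘ Inverse.to (×3-finite finite)
    level : ∀ r b → ¬ Monochromatic (c ∘ block r b) → ∀ p →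
            f₃ (block r b p , cell (L r b) 0F 0F p) ≡ f₃ (block r b p , 0F)
    level r b ¬mono p = cong (λ i → f₃ (block r b p , i))
      (proj₂ (proj₂ (separate (c ∘ block r b))) ¬mono p)
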